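{- Let $P$ be a join-semilattice with a least element $0$, and let $L:=\mathrm{Id}(P)$ be the lattice of ideals of $P$ ordered by inclusion. Suppose that $\dim_\vee(P)=n<\omega$. Then $L$ is order-scattered if and only if $P$ is order-scattered and $P$ has no join-subsemilattice isomorphic to $\Omega(\eta)$.
   Context: An ideal of a poset $P$ is a non-empty initial segment of $P$ that is up-directed. A poset is order-scattered if it contains no subset order-isomorphic to the chain $\mathbb{Q}$ of rationals. The join-dimension $\dim_\vee(P)$ of a join-semilattice $P$ is the least cardinal $\kappa$ such that $P$ admits a one-to-one join-preserving map into a direct product of $\kappa$ chains (with the componentwise order). $\Omega(\eta)$ denotes the join-subsemilattice of the direct product $\mathbb{N}\times D$ (componentwise order), where $\mathbb{N}$ is the chain of non-negative integers and $D$ is the chain of dyadic rationals in $[0,1)$, consisting of the pairs $(n,r)$ with $2^n r\in\mathbb{Z}$; its second projection is all of $D$ and each set $(\{n\}\times D)\cap\Omega(\eta)$ is finite. -}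

module Defs where

open import Algebra.Bundles.Raw using (RawMagma)
open import Algebra.Morphism.Structures using (module MagmaMorphisms)
import Algebra.Construct.NaturalChoice.Max as Max
open import Data.Integer.Base as ℤ using (ℤ)
open import Data.Nat.Base as ℕ using (ℕ)
import Data.Integer.Properties as ℤ
import Data.Nat.Properties as ℕ
open import Data.Product using (Σ; ∃; _×_; _,_; proj₁; proj₂)
open import Data.Product.Relation.Binary.Pointwise.NonDependent using (Pointwise; ×-isPartialOrder)
open import Data.Rational.Base as ℚ using (ℚ; 0ℚ; 1ℚ)
import Data.Rational.Properties as ℚ
import Data.Rational.Unnormalised.Base as ℚᵘ
import Data.Rational.Unnormalised.Properties as ℚᵘ
open import Data.Sum.Base using (_⊎_; inj₁; inj₂)
open import Function.Bundles using (_↣_)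
open import Level using (Level; 0ℓ; _⊔_; suc)
open import Relation.Binary.Bundles using (DecTotalOrder; Poset; TotalOrder)
import Relation.Binary.Construct.On as On
open import Relation.Binary.Lattice.Bundles using (JoinSemilattice)
open import Relation.Binary.Morphism.Structures using (IsOrderMonomorphism)
open import Relation.Binary.PropositionalEquality using (_≡_; cong; subst; sym; module ≡-Reasoning)
open import Relation.Nullary.Negation.Core using (¬_)
open import Relation.Unary using (Pred; Satisfiable)

private
  variable
    a b c d k ℓ ℓ₁ ℓ₂ ℓ₃ ℓ₄ : Level

-- A subset isomorphic to a poset is the same thing as the image of an order
-- embedding of that poset (a map that preserves and reflects the order).
OrderEmbedding : Poset a ℓ₁ ℓ₂ → Poset b ℓ₃ ℓ₄ → Set _
OrderEmbedding P Q = Σ (P.Carrier → Q.Carrier) (IsOrderMonomorphism P._≈_ Q._≈_ P._≤_ Q._≤_)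
  where
  module P = Poset P
  module Q = Poset Q

OrderScattered : Poset a ℓ₁ ℓ₂ → Set _
OrderScattered P = ¬ OrderEmbedding (DecTotalOrder.poset ℚ.≤-decTotalOrder) P

-- Invariance of an ideal under _≈_ follows from `initial`.
record Ideal (P : Poset c ℓ₁ ℓ₂) : Set (suc (c ⊔ ℓ₁ ⊔ ℓ₂)) where
  open Poset P using (Carrier; _≤_)
  field
    member   : Pred Carrier (c ⊔ ℓ₁ ⊔ ℓ₂)
    nonEmpty : Satisfiable member
    initial  : ∀ {x y} → x ≤ y → member y → member x
    directed : ∀ {x y} → member x → member y → ∃ λ z → member z × x ≤ z × y ≤ z

idealPoset : (P : Poset c ℓ₁ ℓ₂) → Poset (suc (c ⊔ ℓ₁ ⊔ ℓ₂)) (c ⊔ ℓ₁ ⊔ ℓ₂) (c ⊔ ℓ₁ ⊔ ℓ₂)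
idealPoset P = record
  { Carrier        = Ideal P
  ; _≈_            = λ I J → (∀ x → member I x → member J x) × (∀ x → member J x → member I x)
  ; _≤_            = λ I J → ∀ x → member I x → member J x
  ; isPartialOrder = record
    { isPreorder = record
      { isEquivalence = record
        { refl  = (λ _ p → p) , (λ _ p → p)
        ; sym   = λ (p , q) → q , p
        ; trans = λ (p , q) (p′ , q′) → (λ x m → p′ x (p x m)) , (λ x m → q x (q′ x m))
        }
      ; reflexive     = proj₁
      ; trans         = λ p q x m → q x (p x m)
      }
    ; antisym    = _,_
    }
  }
  where open Ideal

joinMagma : JoinSemilattice c ℓ₁ ℓ₂ → RawMagma c ℓ₁
joinMagma S = record { Carrier = Carrier ; _≈_ = _≈_ ; _∙_ = _∨_ }
  where open JoinSemilattice S

-- One-to-one join-preserving maps S → T; their images are exactly the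
-- join-subsemilattices of T isomorphic to S.
JoinEmbedding : JoinSemilattice a ℓ₁ ℓ₂ → JoinSemilattice b ℓ₃ ℓ₄ → Set _
JoinEmbedding S T = Σ (JoinSemilattice.Carrier S → JoinSemilattice.Carrier T) IsMagmaMonomorphism
  where open MagmaMorphisms (joinMagma S) (joinMagma T)

chain : TotalOrder c ℓ₁ ℓ₂ → JoinSemilattice c ℓ₁ ℓ₂
chain C = record
  { Carrier           = C.Carrier
  ; _≈_               = C._≈_
  ; _≤_               = C._≤_
  ; _∨_               = M._⊔_
  ; isJoinSemilattice = record
    { isPartialOrder = C.isPartialOrder
    ; supremum       = λ x y → M.x≤x⊔y x y , M.x≤y⊔x x y , λ _ → M.⊔-lub
    }
  }
  where
  module C = TotalOrder C
  module M = Max C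

∏ : {K : Set k} → (K → JoinSemilattice c ℓ₁ ℓ₂) → JoinSemilattice (k ⊔ c) (k ⊔ ℓ₁) (k ⊔ ℓ₂)
∏ {K = K} S = record
  { Carrier           = ∀ i → S.Carrier i
  ; _≈_               = λ x y → ∀ i → S._≈_ i (x i) (y i)
  ; _≤_               = λ x y → ∀ i → S._≤_ i (x i) (y i)
  ; _∨_               = λ x y i → S._∨_ i (x i) (y i)
  ; isJoinSemilattice = record
    { isPartialOrder = record
      { isPreorder = record
        { isEquivalence = record
          { refl  = λ i → S.Eq.refl i
          ; sym   = λ p i → S.Eq.sym i (p i)
          ; trans = λ p q i → S.Eq.trans i (p i) (q i)
          }
        ; reflexive     = λ p i → S.reflexive i (p i)
        ; trans         = λ p q i → S.trans i (p i) (q i)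
        }
      ; antisym    = λ p q i → S.antisym i (p i) (q i)
      }
    ; supremum       = λ x y →
        (λ i → S.x≤x∨y i (x i) (y i)) ,
        (λ i → S.y≤x∨y i (x i) (y i)) ,
        (λ _ p q i → S.∨-least i (p i) (q i))
    }
  }
  where module S (i : K) = JoinSemilattice (S i)

infixr 2 _⊗_

_⊗_ : JoinSemilattice a ℓ₁ ℓ₂ → JoinSemilattice b ℓ₃ ℓ₄ →
      JoinSemilattice (a ⊔ b) (ℓ₁ ⊔ ℓ₃) (ℓ₂ ⊔ ℓ₄)
S ⊗ T = record
  { Carrier           = S.Carrier × T.Carrier
  ; _≈_               = Pointwise S._≈_ T._≈_
  ; _≤_               = Pointwise S._≤_ T._≤_
  ; _∨_               = λ (x , u) (y , v) → x S.∨ y , u T.∨ v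
  ; isJoinSemilattice = record
    { isPartialOrder = ×-isPartialOrder S.isPartialOrder T.isPartialOrder
    ; supremum       = λ (x , u) (y , v) →
        (S.x≤x∨y x y , T.x≤x∨y u v) ,
        (S.y≤x∨y x y , T.y≤x∨y u v) ,
        (λ _ (p , p′) (q , q′) → S.∨-least p q , T.∨-least p′ q′)
    }
  }
  where
  module S = JoinSemilattice S
  module T = JoinSemilattice T

module _ (S : JoinSemilattice c ℓ₁ ℓ₂) where
  private module S = JoinSemilattice S

  subsemilattice : (A : Pred S.Carrier ℓ) → (∀ {x y} → A x → A y → A (x S.∨ y)) →
                   JoinSemilattice (c ⊔ ℓ) ℓ₁ ℓ₂
  subsemilattice A closed = record
    { Carrier           = Σ S.Carrier A
    ; _≈_               = λ x y → proj₁ x S.≈ proj₁ y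
    ; _≤_               = λ x y → proj₁ x S.≤ proj₁ y
    ; _∨_               = λ (x , p) (y , q) → x S.∨ y , closed p q
    ; isJoinSemilattice = record
      { isPartialOrder = On.isPartialOrder proj₁ S.isPartialOrder
      ; supremum       = λ (x , _) (y , _) →
          S.x≤x∨y x y , S.y≤x∨y x y , λ _ → S.∨-least
      }
    }

-- The chains are taken in the universe of P.  This loses nothing classically:
-- each chain can be replaced by the image of P in it, which is P with a
-- coarser equality and order.
EmbedsInProductOf : Set k → JoinSemilattice c ℓ₁ ℓ₂ → Set _
EmbedsInProductOf {c = c} {ℓ₁ = ℓ₁} {ℓ₂ = ℓ₂} K P =
  Σ (K → TotalOrder c ℓ₁ ℓ₂) λ C → JoinEmbedding P (∏ λ i → chain (C i))

-- Cardinals are represented by types, compared by injections: |K| is the least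
-- number of chains.
JoinDimensionIs : Set k → JoinSemilattice c ℓ₁ ℓ₂ → Set _
JoinDimensionIs {k = k} K P =
  EmbedsInProductOf K P × ((K′ : Set k) → EmbedsInProductOf K′ P → K ↣ K′)

Integral : ℕ → ℚ → Set
Integral n r = ∃ λ (z : ℤ) → ((ℤ.+ (2 ℕ.^ n)) ℚ./ 1) ℚ.* r ≡ z ℚ./ 1

record Dyadic : Set where
  field
    value    : ℚ
    0≤value  : 0ℚ ℚ.≤ value
    value<1  : value ℚ.< 1ℚ
    isDyadic : ∃ λ n → Integral n value

open Dyadic public using (value)

D : TotalOrder 0ℓ 0ℓ 0ℓ
D = On.totalOrder (DecTotalOrder.totalOrder ℚ.≤-decTotalOrder) value

/1-homo-* : ∀ x y → (x ℤ.* y) ℚ./ 1 ≡ (x ℚ./ 1) ℚ.* (y ℚ./ 1)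
/1-homo-* x y = ℚ.toℚᵘ-injective (begin
  ℚ.toℚᵘ ((x ℤ.* y) ℚ./ 1)               ≈⟨ ℚ.toℚᵘ-fromℚᵘ (ℚᵘ.mkℚᵘ (x ℤ.* y) 0) ⟩
  ℚᵘ.mkℚᵘ x 0 ℚᵘ.* ℚᵘ.mkℚᵘ y 0           ≈⟨ ℚᵘ.*-cong (ℚ.toℚᵘ-fromℚᵘ (ℚᵘ.mkℚᵘ x 0)) (ℚ.toℚᵘ-fromℚᵘ (ℚᵘ.mkℚᵘ y 0)) ⟨
  ℚ.toℚᵘ (x ℚ./ 1) ℚᵘ.* ℚ.toℚᵘ (y ℚ./ 1) ≈⟨ ℚ.toℚᵘ-homo-* (x ℚ./ 1) (y ℚ./ 1) ⟨
  ℚ.toℚᵘ ((x ℚ./ 1) ℚ.* (y ℚ./ 1))       ∎)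
  where open ℚᵘ.≃-Reasoning

Integral-+ : ∀ m {n r} → Integral n r → Integral (m ℕ.+ n) r
Integral-+ m {n} {r} (z , eq) = ℤ.+ (2 ℕ.^ m) ℤ.* z , (begin
  ((ℤ.+ (2 ℕ.^ (m ℕ.+ n))) ℚ./ 1) ℚ.* r
    ≡⟨ cong (λ t → (ℤ.+ t ℚ./ 1) ℚ.* r) (ℕ.^-distribˡ-+-* 2 m n) ⟩
  ((ℤ.+ (2 ℕ.^ m ℕ.* 2 ℕ.^ n)) ℚ./ 1) ℚ.* r
    ≡⟨ cong (λ t → (t ℚ./ 1) ℚ.* r) (ℤ.pos-* (2 ℕ.^ m) (2 ℕ.^ n)) ⟩
  ((ℤ.+ (2 ℕ.^ m) ℤ.* ℤ.+ (2 ℕ.^ n)) ℚ./ 1) ℚ.* r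
    ≡⟨ cong (ℚ._* r) (/1-homo-* (ℤ.+ (2 ℕ.^ m)) (ℤ.+ (2 ℕ.^ n))) ⟩
  ((ℤ.+ (2 ℕ.^ m) ℚ./ 1) ℚ.* (ℤ.+ (2 ℕ.^ n) ℚ./ 1)) ℚ.* r
    ≡⟨ ℚ.*-assoc (ℤ.+ (2 ℕ.^ m) ℚ./ 1) (ℤ.+ (2 ℕ.^ n) ℚ./ 1) r ⟩
  (ℤ.+ (2 ℕ.^ m) ℚ./ 1) ℚ.* ((ℤ.+ (2 ℕ.^ n) ℚ./ 1) ℚ.* r)
    ≡⟨ cong ((ℤ.+ (2 ℕ.^ m) ℚ./ 1) ℚ.*_) eq ⟩
  (ℤ.+ (2 ℕ.^ m) ℚ./ 1) ℚ.* (z ℚ./ 1)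
    ≡⟨ /1-homo-* (ℤ.+ (2 ℕ.^ m)) z ⟨
  (ℤ.+ (2 ℕ.^ m) ℤ.* z) ℚ./ 1 ∎)
  where
  open ≡-Reasoning

Integral-mono : ∀ {m n r} → m ℕ.≤ n → Integral m r → Integral n r
Integral-mono {m} {n} {r} m≤n p =
  subst (λ t → Integral t r) (ℕ.m∸n+n≡m m≤n) (Integral-+ (n ℕ.∸ m) p)

ℕ×D : JoinSemilattice 0ℓ 0ℓ 0ℓ
ℕ×D = chain ℕ.≤-totalOrder ⊗ chain D

InΩη : Pred (JoinSemilattice.Carrier ℕ×D) 0ℓ
InΩη (n , r) = Integral n (value r)

InΩη-closed : ∀ {x y} → InΩη x → InΩη y → InΩη (JoinSemilattice._∨_ ℕ×D x y)
InΩη-closed {m , r} {n , s} p q = helper (Max.⊔-sel D r s)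
  where
  module N = JoinSemilattice (chain ℕ.≤-totalOrder)
  module E = JoinSemilattice (chain D)

  helper : value (r E.∨ s) ≡ value r ⊎ value (r E.∨ s) ≡ value s → InΩη (m N.∨ n , r E.∨ s)
  helper (inj₁ eq) = subst (Integral (m N.∨ n)) (sym eq) (Integral-mono (N.x≤x∨y m n) p)
  helper (inj₂ eq) = subst (Integral (m N.∨ n)) (sym eq) (Integral-mono (N.y≤x∨y m n) q)

Ωη : JoinSemilattice 0ℓ 0ℓ 0ℓ
Ωη = subsemilattice ℕ×D InΩη (λ {x} {y} → InΩη-closed {x} {y})

{-# OPTIONS --safe #-}
-- Principal ideals embed P in Id(P), and if Ω(η) sits inside P, then the ideals
-- generated by the sets {(m , s) ∣ s ≤ r}, r ∈ D, form a dense chain in Id(P).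
-- Conversely, let (I_q) be a chain of ideals of type ℚ. An ideal of P is
-- determined by its projections to the n chains, and after passing to a
-- subinterval [a , b] of ℚ each projection is either constant ("flat") or strictly
-- increasing ("steep") in q. Choosing elements between the ideals gives φ : ℚ → P,
-- strictly increasing in every steep coordinate. If some h ∈ I_a is maximal in all
-- flat coordinates, then the elements h ∨ φ q form a copy of ℚ in P. Otherwise I_a
-- contains an increasing sequence h_m that never stops growing in the flat
-- coordinates and there dominates φ r for every r ∈ D with 2^m r ∈ ℤ. The steep
-- coordinates of h_m ∨ φ r are those of φ r, the flat ones are those of h_m, so
-- (m , r) ↦ h_m ∨ φ r embeds Ω(η).
module Submission where

open import Defs
open import Axiom.ExcludedMiddle using (ExcludedMiddle)
open import Data.Fin.Base using (Fin)
open import Data.Nat.Base using (ℕ)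
open import Data.Product using (_×_)
open import Function.Bundles using (_⇔_)
open import Relation.Binary.Lattice.Bundles using (BoundedJoinSemilattice)
open import Relation.Nullary.Negation.Core using (¬_)
open BoundedJoinSemilattice using (poset; joinSemilattice)

import Algebra.Construct.NaturalChoice.Max as Max
open import Algebra.Morphism.Structures using (module MagmaMorphisms)
open import Data.Empty using (⊥-elim)
open import Data.Fin.Base using (zero; suc; toℕ; fromℕ<)
import Data.Fin.Properties as Fin
open import Data.Integer.Base as ℤ using (ℤ; +_; -[1+_])
import Data.Integer.Properties as ℤ
open import Data.List.Base using (List; []; _∷_; _++_; map; upTo; cartesianProductWith)
open import Data.List.Membership.Propositional using (_∈_)
open import Data.List.Membership.Propositional.Properties
  using (∈-cartesianProductWith⁺; ∈-upTo⁺; ∈-map⁺; ∈-++⁺ˡ; ∈-++⁺ʳ)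
open import Data.List.Relation.Unary.All as All using (All; []; _∷_)
open import Data.Nat.Base as ℕ using (zero; suc; s≤s; z≤n)
import Data.Nat.Properties as ℕ
open import Data.Product using (Σ; ∃; ∃₂; _,_; proj₁; proj₂)
open import Data.Unit.Base using (⊤; tt)
open import Data.Rational.Base as ℚ using (ℚ; 0ℚ; 1ℚ; ½)
import Data.Rational.Properties as ℚ
import Data.Rational.Unnormalised.Base as ℚᵘ
import Data.Rational.Unnormalised.Properties as ℚᵘ
open import Data.Sum.Base as Sum using (_⊎_; inj₁; inj₂)
open import Function.Bundles using (mk⇔)
open import Level using (Level; Lift; lift; lower; _⊔_)
open import Relation.Binary.Morphism.Structures using (module IsOrderMonomorphism)
open import Relation.Binary.Bundles using (DecTotalOrder; Poset; TotalOrder)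
open import Relation.Binary.Core using (Rel)
open import Relation.Binary.Definitions using (Transitive; tri<; tri≈; tri>)
open import Relation.Binary.Lattice.Bundles using (JoinSemilattice)
import Relation.Binary.Lattice.Properties.JoinSemilattice as JoinProperties
open import Relation.Binary.PropositionalEquality
  using (_≡_; refl; sym; trans; cong; cong₂; subst; module ≡-Reasoning)
open import Relation.Nullary.Decidable.Core using (yes; no; decidable-stable)

private
  variable
    c k ℓ ℓ₁ ℓ₂ : Level

-- Rationals and dyadic rationals

/1-cancel-≤ : ∀ {x y} → x ℚ./ 1 ℚ.≤ y ℚ./ 1 → x ℤ.≤ y
/1-cancel-≤ {x} {y} p
  with ℚᵘ.*≤* q ← ℚᵘ.≤-respˡ-≃ (ℚ.toℚᵘ-fromℚᵘ (ℚᵘ.mkℚᵘ x 0))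
                    (ℚᵘ.≤-respʳ-≃ (ℚ.toℚᵘ-fromℚᵘ (ℚᵘ.mkℚᵘ y 0)) (ℚ.toℚᵘ-mono-≤ p))
  = ℤ.*-cancelʳ-≤-pos x y (+ 1) q

/1-cancel-< : ∀ {x y} → x ℚ./ 1 ℚ.< y ℚ./ 1 → x ℤ.< y
/1-cancel-< {x} {y} p
  with ℚᵘ.*<* q ← ℚᵘ.<-respˡ-≃ (ℚ.toℚᵘ-fromℚᵘ (ℚᵘ.mkℚᵘ x 0))
                    (ℚᵘ.<-respʳ-≃ (ℚ.toℚᵘ-fromℚᵘ (ℚᵘ.mkℚᵘ y 0)) (ℚ.toℚᵘ-mono-< p))
  = ℤ.*-cancelʳ-<-nonNeg (+ 1) q

/1-homo-+ : ∀ x y → (x ℤ.+ y) ℚ./ 1 ≡ (x ℚ./ 1) ℚ.+ (y ℚ./ 1)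
/1-homo-+ x y = ℚ.toℚᵘ-injective (begin
  ℚ.toℚᵘ ((x ℤ.+ y) ℚ./ 1)               ≈⟨ ℚ.toℚᵘ-fromℚᵘ (ℚᵘ.mkℚᵘ (x ℤ.+ y) 0) ⟩
  ℚᵘ.mkℚᵘ (x ℤ.+ y) 0                    ≡⟨ cong₂ (λ s t → ℚᵘ.mkℚᵘ (s ℤ.+ t) 0) (ℤ.*-identityʳ x) (ℤ.*-identityʳ y) ⟨
  ℚᵘ.mkℚᵘ x 0 ℚᵘ.+ ℚᵘ.mkℚᵘ y 0           ≈⟨ ℚᵘ.+-cong (ℚ.toℚᵘ-fromℚᵘ (ℚᵘ.mkℚᵘ x 0)) (ℚ.toℚᵘ-fromℚᵘ (ℚᵘ.mkℚᵘ y 0)) ⟨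
  ℚ.toℚᵘ (x ℚ./ 1) ℚᵘ.+ ℚ.toℚᵘ (y ℚ./ 1) ≈⟨ ℚ.toℚᵘ-homo-+ (x ℚ./ 1) (y ℚ./ 1) ⟨
  ℚ.toℚᵘ ((x ℚ./ 1) ℚ.+ (y ℚ./ 1))       ∎)
  where open ℚᵘ.≃-Reasoning

2^n/1-positive : ∀ n → ℚ.Positive (+ (2 ℕ.^ n) ℚ./ 1)
2^n/1-positive n = ℚ.normalize-pos (2 ℕ.^ n) 1 {{_}} {{ℕ.m^n≢0 2 n}}

2^n/1-nonZero : ∀ n → ℚ.NonZero (+ (2 ℕ.^ n) ℚ./ 1)
2^n/1-nonZero n = ℚ.pos⇒nonZero (+ (2 ℕ.^ n) ℚ./ 1) {{2^n/1-positive n}}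

fraction : ∀ n → Fin (2 ℕ.^ n) → ℚ
fraction n k = (ℚ.1/ (+ (2 ℕ.^ n) ℚ./ 1)) {{2^n/1-nonZero n}} ℚ.* (+ toℕ k ℚ./ 1)

-- Scaling `0 ≤ r < 1` by `2 ^ n` puts the integer into `[0, 2 ^ n)`. Each level of Ω(η) is thus
-- finite and can be bounded inside an ideal.
Integral⇒fraction : ∀ n (r : Dyadic) → Integral n (value r) → ∃ λ k → value r ≡ fraction n k
Integral⇒fraction n r (z , eq) = helper z eq 0≤z z<2^n
  where
  x = + (2 ℕ.^ n) ℚ./ 1
  instance
    x-positive : ℚ.Positive x
    x-positive = 2^n/1-positive n
    x-nonZero : ℚ.NonZero x
    x-nonZero = 2^n/1-nonZero n
    x-nonNegative : ℚ.NonNegative x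
    x-nonNegative = ℚ.pos⇒nonNeg x

  0≤z : ℤ.0ℤ ℤ.≤ z
  0≤z = /1-cancel-≤ (begin
    0ℚ           ≡⟨ ℚ.*-zeroʳ x ⟨
    x ℚ.* 0ℚ      ≤⟨ ℚ.*-monoˡ-≤-nonNeg x (Dyadic.0≤value r) ⟩
    x ℚ.* value r ≡⟨ eq ⟩
    z ℚ./ 1      ∎)
    where open ℚ.≤-Reasoning

  z<2^n : z ℤ.< + (2 ℕ.^ n)
  z<2^n = /1-cancel-< (begin-strict
    z ℚ./ 1      ≡⟨ eq ⟨
    x ℚ.* value r <⟨ ℚ.*-monoʳ-<-pos x (Dyadic.value<1 r) ⟩
    x ℚ.* 1ℚ      ≡⟨ ℚ.*-identityʳ x ⟩
    x            ∎)
    where open ℚ.≤-Reasoning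

  helper : ∀ z → x ℚ.* value r ≡ z ℚ./ 1 → ℤ.0ℤ ℤ.≤ z → z ℤ.< + (2 ℕ.^ n) →
           ∃ λ k → value r ≡ fraction n k
  helper (+ m) eq _ (ℤ.+<+ m<2^n) = fromℕ< m<2^n , (begin
    value r                                  ≡⟨ ℚ.*-identityˡ (value r) ⟨
    1ℚ ℚ.* value r                           ≡⟨ cong (ℚ._* value r) (ℚ.*-inverseˡ x) ⟨
    ℚ.1/ x ℚ.* x ℚ.* value r                 ≡⟨ ℚ.*-assoc (ℚ.1/ x) x (value r) ⟩
    ℚ.1/ x ℚ.* (x ℚ.* value r)               ≡⟨ cong (ℚ.1/ x ℚ.*_) eq ⟩
    ℚ.1/ x ℚ.* (+ m ℚ./ 1)                   ≡⟨ cong (λ t → ℚ.1/ x ℚ.* (+ t ℚ./ 1)) (Fin.toℕ-fromℕ< m<2^n) ⟨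
    ℚ.1/ x ℚ.* (+ toℕ (fromℕ< m<2^n) ℚ./ 1) ∎)
    where open ≡-Reasoning

½*[p+p]≡p : ∀ p → ½ ℚ.* (p ℚ.+ p) ≡ p
½*[p+p]≡p p = begin
  ½ ℚ.* (p ℚ.+ p)       ≡⟨ ℚ.*-distribˡ-+ ½ p p ⟩
  ½ ℚ.* p ℚ.+ ½ ℚ.* p   ≡⟨ ℚ.*-distribʳ-+ p ½ ½ ⟨
  1ℚ ℚ.* p              ≡⟨ ℚ.*-identityˡ p ⟩
  p                     ∎
  where open ≡-Reasoning

p<midpoint : ∀ {p q} → p ℚ.< q → p ℚ.< ½ ℚ.* (p ℚ.+ q)
p<midpoint {p} {q} p<q =
  subst (ℚ._< ½ ℚ.* (p ℚ.+ q)) (½*[p+p]≡p p) (ℚ.*-monoʳ-<-pos ½ (ℚ.+-monoʳ-< p p<q))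

midpoint<q : ∀ {p q} → p ℚ.< q → ½ ℚ.* (p ℚ.+ q) ℚ.< q
midpoint<q {p} {q} p<q =
  subst (½ ℚ.* (p ℚ.+ q) ℚ.<_) (½*[p+p]≡p q) (ℚ.*-monoʳ-<-pos ½ (ℚ.+-monoˡ-< q p<q))

Integral-midpoint : ∀ n {p q} → Integral n p → Integral n q → Integral (suc n) (½ ℚ.* (p ℚ.+ q))
Integral-midpoint n {p} {q} (y , y-eq) (z , z-eq) = y ℤ.+ z , (begin
  (+ (2 ℕ.* 2 ℕ.^ n) ℚ./ 1) ℚ.* (½ ℚ.* (p ℚ.+ q))
    ≡⟨ cong (λ t → (t ℚ./ 1) ℚ.* (½ ℚ.* (p ℚ.+ q))) (trans (ℤ.pos-* 2 (2 ℕ.^ n)) (ℤ.*-comm (+ 2) (+ (2 ℕ.^ n)))) ⟩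
  ((+ (2 ℕ.^ n) ℤ.* + 2) ℚ./ 1) ℚ.* (½ ℚ.* (p ℚ.+ q))
    ≡⟨ cong (ℚ._* (½ ℚ.* (p ℚ.+ q))) (/1-homo-* (+ (2 ℕ.^ n)) (+ 2)) ⟩
  (x ℚ.* two) ℚ.* (½ ℚ.* (p ℚ.+ q))
    ≡⟨ ℚ.*-assoc x two (½ ℚ.* (p ℚ.+ q)) ⟩
  x ℚ.* (two ℚ.* (½ ℚ.* (p ℚ.+ q)))
    ≡⟨ cong (x ℚ.*_) (ℚ.*-assoc two ½ (p ℚ.+ q)) ⟨
  x ℚ.* (1ℚ ℚ.* (p ℚ.+ q))
    ≡⟨ cong (x ℚ.*_) (ℚ.*-identityˡ (p ℚ.+ q)) ⟩
  x ℚ.* (p ℚ.+ q)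
    ≡⟨ ℚ.*-distribˡ-+ x p q ⟩
  x ℚ.* p ℚ.+ x ℚ.* q
    ≡⟨ cong₂ ℚ._+_ y-eq z-eq ⟩
  (y ℚ./ 1) ℚ.+ (z ℚ./ 1)
    ≡⟨ /1-homo-+ y z ⟨
  (y ℤ.+ z) ℚ./ 1 ∎)
  where
  open ≡-Reasoning
  x = + (2 ℕ.^ n) ℚ./ 1
  two = + 2 ℚ./ 1

Dyadic-dense : ∀ {r s} → value r ℚ.< value s → ∃ λ t → value r ℚ.< value t × value t ℚ.< value s
Dyadic-dense {r} {s} r<s = t , p<midpoint r<s , midpoint<q r<s
  where
  module r = Dyadic r
  module s = Dyadic s
  t : Dyadic
  t = record
    { value    = ½ ℚ.* (r.value ℚ.+ s.value)
    ; 0≤value  = ℚ.<⇒≤ (ℚ.≤-<-trans r.0≤value (p<midpoint r<s))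
    ; value<1  = ℚ.<-trans (midpoint<q r<s) s.value<1
    ; isDyadic = let m , p = r.isDyadic ; n , q = s.isDyadic in
        suc (m ℕ.+ n) ,
        Integral-midpoint (m ℕ.+ n) (Integral-mono (ℕ.m≤m+n m n) p) (Integral-mono (ℕ.m≤n+m n m) q)
    }

0ᴰ ½ᴰ : Dyadic
0ᴰ = record { value = 0ℚ ; 0≤value = ℚ.≤-refl ; value<1 = ℚ.positive⁻¹ 1ℚ ; isDyadic = 0 , + 0 , refl }
½ᴰ = record
  { value    = ½
  ; 0≤value  = ℚ.<⇒≤ (ℚ.positive⁻¹ ½)
  ; value<1  = ℚ.*<* (ℤ.+<+ (s≤s (s≤s z≤n)))
  ; isDyadic = 1 , + 1 , refl
  }

<⇒≱ : ∀ {p q} → p ℚ.< q → ¬ q ℚ.≤ p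
<⇒≱ p<q q≤p = ℚ.<-irrefl refl (ℚ.<-≤-trans p<q q≤p)

-- ℚ is exhausted by finite stages. Repetitions are harmless, because inserting a key that is
-- already present changes nothing.
rationals : ℕ → List ℚ
rationals n = cartesianProductWith (λ z d → z ℚ./ suc d) (map +_ (upTo n) ++ map -[1+_] (upTo n)) (upTo n)

∈-rationals : ∀ q → ∃ λ n → q ∈ rationals n
∈-rationals q = n , subst (_∈ rationals n) (ℚ.↥p/↧p≡p q)
    (∈-cartesianProductWith⁺ _ (numerator (ℚ.↥ q) (s≤s (ℕ.m≤m+n _ _))) (∈-upTo⁺ (s≤s (ℕ.m≤n+m _ _))))
  where
  n = suc (ℤ.∣ ℚ.↥ q ∣ ℕ.+ ℚ.denominator-1 q)

  numerator : ∀ z → ℤ.∣ z ∣ ℕ.< n → z ∈ map +_ (upTo n) ++ map -[1+_] (upTo n)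
  numerator (+ m)    m<n = ∈-++⁺ˡ (∈-map⁺ +_ (∈-upTo⁺ m<n))
  numerator -[1+ m ] m<n = ∈-++⁺ʳ (map +_ (upTo n)) (∈-map⁺ -[1+_] (∈-upTo⁺ (ℕ.<⇒≤ m<n)))

-- Dense transitive relations

module DenseRelation {x r} {X : Set x} (_≺_ : Rel X r) (≺-trans : Transitive _≺_)
  (≺-dense : ∀ {x y} → x ≺ y → ∃ λ z → x ≺ z × z ≺ y) where

  -- Search trees, read as finite partial maps from ℚ to X: the value at a node is
  -- the common bound of its two subtrees.
  data Tree : X → X → Set (x ⊔ r) where
    leaf : ∀ {lo hi} → lo ≺ hi → Tree lo hi
    node : ∀ {lo mid hi} → ℚ → Tree lo mid → Tree mid hi → Tree lo hi

  private
    variable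
      lo mid hi y z : X
      p q : ℚ

  -- The indices of `Tree` order the values only. The order of the keys is recorded along search
  -- paths, so a key counts only where a search for it leads.
  data _↦_∈ᵗ_ (q : ℚ) : X → Tree lo hi → Set (x ⊔ r) where
    here  : {t₁ : Tree lo mid} {t₂ : Tree mid hi} → q ↦ mid ∈ᵗ node q t₁ t₂
    left  : {t₁ : Tree lo mid} {t₂ : Tree mid hi} → q ℚ.< p → q ↦ y ∈ᵗ t₁ → q ↦ y ∈ᵗ node p t₁ t₂
    right : {t₁ : Tree lo mid} {t₂ : Tree mid hi} → p ℚ.< q → q ↦ y ∈ᵗ t₂ → q ↦ y ∈ᵗ node p t₁ t₂

  _⊆ᵗ_ : Rel (Tree lo hi) _
  t₁ ⊆ᵗ t₂ = ∀ {q y} → q ↦ y ∈ᵗ t₁ → q ↦ y ∈ᵗ t₂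

  bounds : Tree lo hi → lo ≺ hi
  bounds (leaf lo≺hi)   = lo≺hi
  bounds (node _ t₁ t₂) = ≺-trans (bounds t₁) (bounds t₂)

  value-bounds : {t : Tree lo hi} → q ↦ y ∈ᵗ t → lo ≺ y × y ≺ hi
  value-bounds (here {t₁ = t₁} {t₂ = t₂})    = bounds t₁ , bounds t₂
  value-bounds (left {t₂ = t₂} _ q∈t₁)       = let lo≺y , y≺mid = value-bounds q∈t₁ in lo≺y , ≺-trans y≺mid (bounds t₂)
  value-bounds (right {t₁ = t₁} _ q∈t₂)      = let mid≺y , y≺hi = value-bounds q∈t₂ in ≺-trans (bounds t₁) mid≺y , y≺hi

  -- At the node where the two search paths part, `mid` separates `y` from `z` or is one of them.
  ∈ᵗ-mono : {t : Tree lo hi} → p ℚ.< q → p ↦ y ∈ᵗ t → q ↦ z ∈ᵗ t → y ≺ z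
  ∈ᵗ-mono p<q here          here          = ⊥-elim (ℚ.<-irrefl refl p<q)
  ∈ᵗ-mono p<q here          (left q<p _)  = ⊥-elim (ℚ.<-asym p<q q<p)
  ∈ᵗ-mono p<q here          (right _ q∈)  = proj₁ (value-bounds q∈)
  ∈ᵗ-mono p<q (left _ p∈)   here          = proj₂ (value-bounds p∈)
  ∈ᵗ-mono p<q (left _ p∈)   (left _ q∈)   = ∈ᵗ-mono p<q p∈ q∈
  ∈ᵗ-mono p<q (left _ p∈)   (right _ q∈)  = ≺-trans (proj₂ (value-bounds p∈)) (proj₁ (value-bounds q∈))
  ∈ᵗ-mono p<q (right q<p _) here          = ⊥-elim (ℚ.<-asym p<q q<p)
  ∈ᵗ-mono p<q (right k<p _) (left q<k _)  = ⊥-elim (ℚ.<-asym p<q (ℚ.<-trans q<k k<p))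
  ∈ᵗ-mono p<q (right _ p∈)  (right _ q∈)  = ∈ᵗ-mono p<q p∈ q∈

  -- The search for a new key ends at a leaf, where `≺-dense` supplies a value between the two
  -- bounds.
  insert : ∀ q (t : Tree lo hi) → Σ (Tree lo hi) λ t′ → t ⊆ᵗ t′ × ∃ λ y → q ↦ y ∈ᵗ t′
  insert q (leaf lo≺hi) = let y , lo≺y , y≺hi = ≺-dense lo≺hi in
    node q (leaf lo≺y) (leaf y≺hi) , (λ ()) , y , here
  insert q (node p t₁ t₂) with ℚ.<-cmp q p
  ... | tri< q<p _ _ = let t₁′ , t₁⊆ , y , q∈ = insert q t₁ in
    node p t₁′ t₂ , (λ { here → here ; (left l m) → left l (t₁⊆ m) ; (right l m) → right l m }) , y , left q<p q∈
  ... | tri≈ _ refl _ = node p t₁ t₂ , (λ m → m) , _ , here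
  ... | tri> _ _ p<q = let t₂′ , t₂⊆ , y , q∈ = insert q t₂ in
    node p t₁ t₂′ , (λ { here → here ; (left l m) → left l m ; (right l m) → right l (t₂⊆ m) }) , y , right p<q q∈

  insertAll : ∀ qs (t : Tree lo hi) → Σ (Tree lo hi) λ t′ → t ⊆ᵗ t′ × All (λ q → ∃ λ y → q ↦ y ∈ᵗ t′) qs
  insertAll []       t = t , (λ m → m) , []
  insertAll (q ∷ qs) t =
    let t₁ , t⊆t₁ , y , q∈t₁ = insert q t
        t₂ , t₁⊆t₂ , qs∈t₂   = insertAll qs t₁
    in  t₂ , (λ m → t₁⊆t₂ (t⊆t₁ m)) , (y , t₁⊆t₂ q∈t₁) ∷ qs∈t₂

  abstract
    -- The forth half of Cantor's back-and-forth argument: each rational receives a value at a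
    -- finite stage and keeps it.
    ℚ-embeds : lo ≺ hi → ∃ λ (f : ℚ → X) →
      (∀ q → lo ≺ f q × f q ≺ hi) × (∀ {p q} → p ℚ.< q → f p ≺ f q)
    ℚ-embeds {lo} {hi} lo≺hi = (λ q → proj₁ (assigned q)) , (λ q → value-bounds (proj₂ (assigned q))) , mono
      where
      tree : ℕ → Tree lo hi
      tree zero    = leaf lo≺hi
      tree (suc n) = proj₁ (insertAll (rationals n) (tree n))

      tree-⊆ : ∀ m n → tree n ⊆ᵗ tree (m ℕ.+ n)
      tree-⊆ zero    n q∈ = q∈
      tree-⊆ (suc m) n q∈ = proj₁ (proj₂ (insertAll (rationals (m ℕ.+ n)) (tree (m ℕ.+ n)))) (tree-⊆ m n q∈)

      stage : ℚ → ℕ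
      -- The `n`-th list is inserted in passing from tree `n` to tree `suc n`.
      stage q = suc (proj₁ (∈-rationals q))

      assigned : ∀ q → ∃ λ y → q ↦ y ∈ᵗ tree (stage q)
      assigned q = let n , q∈ = ∈-rationals q in
        All.lookup (proj₂ (proj₂ (insertAll (rationals n) (tree n)))) q∈

      mono : ∀ {p q} → p ℚ.< q → proj₁ (assigned p) ≺ proj₁ (assigned q)
      -- Both values are carried to one tree, at the sum of the two stages.
      mono {p} {q} p<q = ∈ᵗ-mono p<q
        (subst (λ n → p ↦ proj₁ (assigned p) ∈ᵗ tree n) (ℕ.+-comm (stage q) (stage p)) (tree-⊆ (stage q) (stage p) (proj₂ (assigned p))))
        (tree-⊆ (stage p) (stage q) (proj₂ (assigned q)))

-- Order embeddings of ℚ and join embeddings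

ℚ-poset : Poset _ _ _
ℚ-poset = DecTotalOrder.poset ℚ.≤-decTotalOrder

module _ (Q : Poset c ℓ₁ ℓ₂) where
  private module Q = Poset Q

  -- As ℚ is total, a failure of `p ≤ q` means `q < p`; strictness therefore yields reflection of
  -- the order, hence injectivity.
  strictlyMonotone⇒OrderEmbedding : (f : ℚ → Q.Carrier) →
    (∀ {p q} → p ℚ.< q → f p Q.≤ f q × ¬ f q Q.≤ f p) → OrderEmbedding ℚ-poset Q
  strictlyMonotone⇒OrderEmbedding f strict = f , record
    { isOrderHomomorphism = record { cong = λ { refl → Q.Eq.refl } ; mono = mono }
    ; injective           = λ eq → ℚ.≤-antisym (cancel (Q.reflexive eq)) (cancel (Q.reflexive (Q.Eq.sym eq)))
    ; cancel              = cancel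
    }
    where
    mono : ∀ {p q} → p ℚ.≤ q → f p Q.≤ f q
    mono {p} {q} p≤q with ℚ.<-cmp p q
    ... | tri< p<q _ _  = proj₁ (strict p<q)
    ... | tri≈ _ refl _ = Q.refl
    ... | tri> _ _ q<p  = ⊥-elim (<⇒≱ q<p p≤q)

    cancel : ∀ {p q} → f p Q.≤ f q → p ℚ.≤ q
    cancel fp≤fq = ℚ.≮⇒≥ λ q<p → proj₂ (strict q<p) fp≤fq

module JoinEmbeddingProperties {a ℓ₃ ℓ₄} {S : JoinSemilattice a ℓ₃ ℓ₄} {T : JoinSemilattice c ℓ₁ ℓ₂}
  (F : JoinEmbedding S T) where
  private
    module S = JoinSemilattice S
    module T = JoinSemilattice T
    f = proj₁ F
  open MagmaMorphisms.IsMagmaMonomorphism (proj₂ F) public using (⟦⟧-cong; homo; injective)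

  ≤-mono : ∀ {x y} → x S.≤ y → f x T.≤ f y
  ≤-mono {x} {y} x≤y = T.trans (T.x≤x∨y (f x) (f y))
    (T.reflexive (T.Eq.trans (T.Eq.sym (homo x y)) (⟦⟧-cong (JoinProperties.x≤y⇒x∨y≈y S x≤y))))

  ≤-cancel : ∀ {x y} → f x T.≤ f y → x S.≤ y
  ≤-cancel {x} {y} fx≤fy = S.trans (S.x≤x∨y x y)
    (S.reflexive (injective (T.Eq.trans (homo x y) (JoinProperties.x≤y⇒x∨y≈y T fx≤fy))))

-- Ideals of a join-semilattice

module _ (S : JoinSemilattice c ℓ₁ ℓ₂) where
  open JoinSemilattice S using (Carrier; _≤_) renaming (refl to ≤-refl; trans to ≤-trans)
  private Sᵖ = JoinSemilattice.poset S

  generatedIdeal : ∀ {I : Set} (g : I → Carrier) → I →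
                   (∀ i j → ∃ λ k → g i ≤ g k × g j ≤ g k) → Ideal Sᵖ
  generatedIdeal g i₀ directed = record
    { member   = λ x → Lift (c ⊔ ℓ₁ ⊔ ℓ₂) (∃ λ i → x ≤ g i)
    ; nonEmpty = g i₀ , lift (i₀ , ≤-refl)
    ; initial  = λ { x≤y (lift (i , y≤gi)) → lift (i , ≤-trans x≤y y≤gi) }
    ; directed = λ { (lift (i , x≤gi)) (lift (j , y≤gj)) →
        let k , gi≤gk , gj≤gk = directed i j in
        g k , lift (k , ≤-refl) , ≤-trans x≤gi gi≤gk , ≤-trans y≤gj gj≤gk }
    }

  scattered-Id⇒scattered : OrderScattered (idealPoset Sᵖ) → OrderScattered Sᵖ
  scattered-Id⇒scattered scattered (f , isMono) =
    scattered (strictlyMonotone⇒OrderEmbedding (idealPoset Sᵖ) principal strict)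
    where
    open IsOrderMonomorphism isMono

    principal : ℚ → Ideal Sᵖ
    principal q = generatedIdeal {⊤} (λ _ → f q) tt λ _ _ → tt , ≤-refl , ≤-refl

    open Poset (idealPoset Sᵖ) using () renaming (_≤_ to _⊆_)

    strict : ∀ {p q} → p ℚ.< q → principal p ⊆ principal q × ¬ principal q ⊆ principal p
    strict {p} {q} p<q =
      (λ { x (lift (_ , x≤fp)) → lift (tt , ≤-trans x≤fp (mono (ℚ.<⇒≤ p<q))) }) ,
      λ q⊆p → <⇒≱ p<q (cancel (proj₂ (lower (q⊆p (f q) (lift (tt , ≤-refl))))))

  -- For `p < q` no generator of `below p` dominates the image of `top q`, since `F` reflects the
  -- order in the second coordinate. The level chosen in `top q` is immaterial to this.
  scattered-Id⇒no-Ωη : OrderScattered (idealPoset Sᵖ) → ¬ JoinEmbedding Ωη S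
  scattered-Id⇒no-Ωη scattered F =
    scattered (strictlyMonotone⇒OrderEmbedding (idealPoset Sᵖ) below strict)
    where
    open JoinEmbeddingProperties {S = Ωη} {T = S} F using (≤-mono; ≤-cancel)
    module Ω = JoinSemilattice Ωη
    open Poset (idealPoset Sᵖ) using () renaming (_≤_ to _⊆_)

    ℚ↪D = DenseRelation.ℚ-embeds (λ r s → value r ℚ.< value s)
      (λ {r} {s} {t} → ℚ.<-trans {value r} {value s} {value t})
      (λ {r} {s} → Dyadic-dense {r} {s}) {0ᴰ} {½ᴰ} (ℚ.positive⁻¹ ½)

    d : ℚ → Dyadic
    d = proj₁ ℚ↪D

    d-mono : ∀ {p q} → p ℚ.< q → value (d p) ℚ.< value (d q)
    d-mono = proj₂ (proj₂ ℚ↪D)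

    Below : ℚ → Set
    Below q = Σ Ω.Carrier λ ω → value (proj₂ (proj₁ ω)) ℚ.≤ value (d q)

    top : ∀ q → Below q
    top q = let n , p = Dyadic.isDyadic (d q) in ((n , d q) , p) , ℚ.≤-refl

    below-directed : ∀ q (ω υ : Below q) → ∃ λ (χ : Below q) →
      proj₁ F (proj₁ ω) ≤ proj₁ F (proj₁ χ) × proj₁ F (proj₁ υ) ≤ proj₁ F (proj₁ χ)
    below-directed q (ω , r≤dq) (υ , s≤dq) =
      (ω Ω.∨ υ , JoinSemilattice.∨-least (chain D) {proj₂ (proj₁ ω)} {proj₂ (proj₁ υ)} {d q} r≤dq s≤dq) ,
      ≤-mono (Ω.x≤x∨y ω υ) , ≤-mono (Ω.y≤x∨y ω υ)

    below : ℚ → Ideal Sᵖ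
    below q = generatedIdeal (λ (ω : Below q) → proj₁ F (proj₁ ω)) (top q) (below-directed q)

    strict : ∀ {p q} → p ℚ.< q → below p ⊆ below q × ¬ below q ⊆ below p
    strict {p} {q} p<q =
      (λ { x (lift ((ω , r≤dp) , x≤)) → lift ((ω , ℚ.≤-trans r≤dp (ℚ.<⇒≤ (d-mono p<q))) , x≤) }) ,
      λ q⊆p → absurd (lower (q⊆p _ (lift (top q , ≤-refl))))
      where
      absurd : ¬ ∃ λ (ω : Below p) → proj₁ F (proj₁ (top q)) ≤ proj₁ F (proj₁ ω)
      absurd ((ω , r≤dp) , Ftop≤Fω) =
        <⇒≱ (d-mono p<q) (ℚ.≤-trans (proj₂ (≤-cancel {proj₁ (top q)} {ω} Ftop≤Fω)) r≤dp)

-- Join-semilattices embedded in a product of chains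

-- The chains are replaced by the preorders they induce on S.
record Realizer (S : JoinSemilattice c ℓ₁ ℓ₂) (K : Set k) : Set (c ⊔ k ⊔ Level.suc ℓ₂) where
  open JoinSemilattice S using (Carrier; _≤_; _∨_)
  field
    _≤[_]_    : Carrier → K → Carrier → Set ℓ₂
    ≤[]-total : ∀ i x y → x ≤[ i ] y ⊎ y ≤[ i ] x
    ≤[]-trans : ∀ {i x y z} → x ≤[ i ] y → y ≤[ i ] z → x ≤[ i ] z
    ≤[]-lub   : ∀ {i x y z} → x ≤[ i ] z → y ≤[ i ] z → (x ∨ y) ≤[ i ] z
    ≤⇒≤[]     : ∀ {i x y} → x ≤ y → x ≤[ i ] y
    ≤[]⇒≤     : ∀ {x y} → (∀ i → x ≤[ i ] y) → x ≤ y

realizer : ∀ {S : JoinSemilattice c ℓ₁ ℓ₂} {K : Set k} → EmbedsInProductOf K S → Realizer S K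
realizer {S = S} {K} (C , F) = record
  { _≤[_]_    = λ x i y → C._≤_ i (π x i) (π y i)
  ; ≤[]-total = λ i x y → C.total i (π x i) (π y i)
  ; ≤[]-trans = λ {i} → C.trans i
  ; ≤[]-lub   = λ {i} {x} {y} p q →
      C.trans i (C.reflexive i (homo x y i)) (JoinSemilattice.∨-least (chain (C i)) p q)
  ; ≤⇒≤[]     = λ {i} x≤y → ≤-mono x≤y i
  ; ≤[]⇒≤     = ≤-cancel
  }
  where
  module C (i : K) = TotalOrder (C i)
  π = proj₁ F
  open JoinEmbeddingProperties {S = S} {T = ∏ (λ i → chain (C i))} F

Hereditary : (ℚ → ℚ → Set ℓ) → Set ℓ
Hereditary R = ∀ {a b a′ b′} → a ℚ.≤ a′ → b′ ℚ.≤ b → R a b → R a′ b′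

-- The interval is shrunk once per coordinate, and heredity preserves what the earlier shrinkings
-- achieved.
subinterval : ∀ {m} (R : Fin m → ℚ → ℚ → Set ℓ) → (∀ i → Hereditary (R i)) →
  (∀ i {a b} → a ℚ.< b → ∃₂ λ a′ b′ → a ℚ.≤ a′ × a′ ℚ.< b′ × b′ ℚ.≤ b × R i a′ b′) →
  ∀ {a b} → a ℚ.< b → ∃₂ λ a′ b′ → a′ ℚ.< b′ × (∀ i → R i a′ b′)
subinterval {m = zero}  R hereditary attained a<b = _ , _ , a<b , λ ()
subinterval {m = suc m} R hereditary attained a<b =
  let a′ , b′ , a′<b′ , all = subinterval (λ i → R (suc i)) (λ i → hereditary (suc i)) (λ i → attained (suc i)) a<b
      a″ , b″ , a′≤a″ , a″<b″ , b″≤b′ , first = attained zero a′<b′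
  in  a″ , b″ , a″<b″ , λ { zero → first ; (suc i) → hereditary (suc i) a′≤a″ b″≤b′ (all i) }

-- Projections of ideals to the chains

module Ideals {S : JoinSemilattice c ℓ₁ ℓ₂} {n} (R : Realizer S (Fin n)) where
  open JoinSemilattice S
    using (Carrier; _≤_; _∨_; x≤x∨y; y≤x∨y; ∨-least)
    renaming (refl to ≤-refl; trans to ≤-trans)
  open Realizer R
  open Ideal

  ℐ : Set _
  ℐ = Ideal (JoinSemilattice.poset S)

  -- The initial segment generated by the projection of `I` to the `i`-th chain, pulled back to the
  -- semilattice.
  Below : Fin n → ℐ → Carrier → Set _
  Below i I x = ∃ λ y → member I y × x ≤[ i ] y

  Below-initial : ∀ {i} (I : ℐ) {x y} → x ≤[ i ] y → Below i I y → Below i I x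
  Below-initial I x≤y (z , z∈I , y≤z) = z , z∈I , ≤[]-trans x≤y y≤z

  member⇒Below : ∀ {i} (I : ℐ) {x} → member I x → Below i I x
  member⇒Below I {x} x∈I = x , x∈I , ≤⇒≤[] ≤-refl

  ∨-closed : ∀ (I : ℐ) {x y} → member I x → member I y → member I (x ∨ y)
  ∨-closed I x∈I y∈I = let z , z∈I , x≤z , y≤z = directed I x∈I y∈I in initial I (∨-least x≤z y≤z) z∈I

  finite-bound : ∀ (I : ℐ) {m} (x : Fin m → Carrier) → (∀ k → member I (x k)) →
                 ∃ λ z → member I z × (∀ k → x k ≤ z)
  finite-bound I {zero}  x x∈I = let z , z∈I = nonEmpty I in z , z∈I , λ ()
  finite-bound I {suc m} x x∈I =
    let z , z∈I , x≤z = finite-bound I (λ k → x (suc k)) (λ k → x∈I (suc k)) in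
    x zero ∨ z , ∨-closed I (x∈I zero) z∈I ,
    λ { zero → x≤x∨y _ _ ; (suc k) → ≤-trans (x≤z k) (y≤x∨y _ _) }

  -- Hence an ideal is determined by its projections to the chains.
  Below⇒member : ∀ (I : ℐ) {x} → (∀ i → Below i I x) → member I x
  Below⇒member I below =
    let z , z∈I , y≤z = finite-bound I (λ i → proj₁ (below i)) (λ i → proj₁ (proj₂ (below i))) in
    initial I (≤[]⇒≤ λ i → ≤[]-trans (proj₂ (proj₂ (below i))) (≤⇒≤[] (y≤z i))) z∈I

-- A chain of ideals of type ℚ, and the subintervals on which every projection is flat or steep

module IdealChain (em : ∀ {ℓ} → ExcludedMiddle ℓ) {S : JoinSemilattice c ℓ₁ ℓ₂} {n} (R : Realizer S (Fin n))
  (I : OrderEmbedding ℚ-poset (idealPoset (JoinSemilattice.poset S))) where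
  open JoinSemilattice S
    using (Carrier; _≈_; _≤_; _∨_; x≤x∨y; y≤x∨y; ∨-least; antisym; module Eq)
    renaming (refl to ≤-refl; trans to ≤-trans; reflexive to ≤-reflexive)
  open Realizer R
  open Ideals R
  open Ideal
  open IsOrderMonomorphism (proj₂ I) using (mono; cancel)

  e : ℚ → ℐ
  e = proj₁ I

  e-mono : ∀ {p q x} → p ℚ.≤ q → member (e p) x → member (e q) x
  e-mono p≤q = mono p≤q _

  Below-mono : ∀ {i p q x} → p ℚ.≤ q → Below i (e p) x → Below i (e q) x
  Below-mono p≤q (y , y∈ , x≤y) = y , e-mono p≤q y∈ , x≤y

  -- The converse inclusion is `Below-mono`, so the `i`-th projection is constant on `[a , b]`.
  Flat : Fin n → ℚ → ℚ → Set _
  Flat i a b = ∀ x → member (e b) x → Below i (e a) x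

  Steep : Fin n → ℚ → ℚ → Set _
  Steep i a b = ∀ {p q} → a ℚ.≤ p → p ℚ.< q → q ℚ.≤ b → ∃ λ x → member (e q) x × ¬ Below i (e p) x

  FlatOrSteep : Fin n → ℚ → ℚ → Set _
  FlatOrSteep i a b = Flat i a b ⊎ Steep i a b

  FlatOrSteep-hereditary : ∀ i → Hereditary (FlatOrSteep i)
  FlatOrSteep-hereditary i a≤a′ b′≤b (inj₁ flat)  = inj₁ λ x x∈ → Below-mono a≤a′ (flat x (e-mono b′≤b x∈))
  FlatOrSteep-hereditary i a≤a′ b′≤b (inj₂ steep) =
    inj₂ λ a′≤p p<q q≤b′ → steep (ℚ.≤-trans a≤a′ a′≤p) p<q (ℚ.≤-trans q≤b′ b′≤b)

  -- Either some subinterval is flat, or no pair `p < q` in `[a , b]` is, which is classically the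
  -- same as being steep.
  FlatOrSteep-attained : ∀ i {a b} → a ℚ.< b →
    ∃₂ λ a′ b′ → a ℚ.≤ a′ × a′ ℚ.< b′ × b′ ℚ.≤ b × FlatOrSteep i a′ b′
  FlatOrSteep-attained i {a} {b} a<b
    with em {P = ∃₂ λ p q → a ℚ.≤ p × p ℚ.< q × q ℚ.≤ b × Flat i p q}
  ... | yes (p , q , a≤p , p<q , q≤b , flat) = p , q , a≤p , p<q , q≤b , inj₁ flat
  ... | no noFlat = a , b , ℚ.≤-refl , a<b , ℚ.≤-refl , inj₂ λ {p} {q} a≤p p<q q≤b →
    decidable-stable em λ noPoint → noFlat (p , q , a≤p , p<q , q≤b , λ x x∈ →
      decidable-stable em λ ¬below → noPoint (x , x∈ , ¬below))

  module Interval {a b} (a<b : a ℚ.< b) (flatOrSteep : ∀ i → FlatOrSteep i a b) where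

    -- If all coordinates were flat, `e b` would be contained in `e a`, giving `b ≤ a`.
    some-steep : ∃ λ i → Steep i a b
    some-steep = decidable-stable em λ noSteep → <⇒≱ a<b (cancel λ x x∈ →
      Below⇒member (e a) λ i → flat-at noSteep i (flatOrSteep i) x x∈)
      where
      flat-at : ¬ (∃ λ i → Steep i a b) → ∀ i → FlatOrSteep i a b → Flat i a b
      flat-at noSteep i (inj₁ flat)  = flat
      flat-at noSteep i (inj₂ steep) = ⊥-elim (noSteep (i , steep))

    Above : ℚ → Carrier → Set _
    Above q x = ∀ i → Steep i a b → ¬ Below i (e q) x

    -- The gap `p < q` between the two ideals is what makes the relation dense.
    _≺_ : Rel Carrier _
    x ≺ y = ∃₂ λ p q → a ℚ.≤ p × p ℚ.< q × q ℚ.≤ b × member (e p) x × Above q y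

    -- One witness is taken per steep coordinate. An upper bound of all of them in `e q` still
    -- escapes `e p` in each, as `Below` is closed downwards.
    member-Above : ∀ {p q} → a ℚ.≤ p → p ℚ.< q → q ℚ.≤ b → ∃ λ x → member (e q) x × Above p x
    member-Above {p} {q} a≤p p<q q≤b =
      let z , z∈ , x≤z = finite-bound (e q) (λ i → proj₁ (point i)) (λ i → proj₁ (proj₂ (point i))) in
      z , z∈ , λ i steep z-below → proj₂ (proj₂ (point i)) steep (Below-initial (e p) (≤⇒≤[] (x≤z i)) z-below)
      where
      point : ∀ i → ∃ λ x → member (e q) x × (Steep i a b → ¬ Below i (e p) x)
      point i with em {P = Steep i a b}
      ... | yes steep = let x , x∈ , ¬below = steep a≤p p<q q≤b in x , x∈ , λ _ → ¬below
      -- A default value: only steep coordinates impose a condition.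
      ... | no ¬steep = let x , x∈ = nonEmpty (e q) in x , x∈ , λ steep → ⊥-elim (¬steep steep)

    Above⇒< : ∀ {p q x} → member (e p) x → Above q x → q ℚ.< p
    Above⇒< x∈ above = let i , steep = some-steep in
      ℚ.≰⇒> λ p≤q → above i steep (member⇒Below (e _) (e-mono p≤q x∈))

    ≺-trans : Transitive _≺_
    ≺-trans (p , q , a≤p , p<q , _ , x∈ , y-above) (p′ , q′ , _ , p′<q′ , q′≤b , y∈ , z-above) =
      p , q′ , a≤p , ℚ.<-trans p<q (ℚ.<-trans (Above⇒< y∈ y-above) p′<q′) , q′≤b , x∈ , z-above

    ≺-dense : ∀ {x y} → x ≺ y → ∃ λ z → x ≺ z × z ≺ y
    ≺-dense (p , q , a≤p , p<q , q≤b , x∈ , y-above) =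
      -- Taking `z` between `e u` and `e v` leaves the gaps `p < u` and `v < q` on its two sides.
      let u , p<u , u<q = ℚ.<-dense p<q
          v , u<v , v<q = ℚ.<-dense u<q
          a≤u = ℚ.≤-trans a≤p (ℚ.<⇒≤ p<u)
          v≤b = ℚ.≤-trans (ℚ.<⇒≤ v<q) q≤b
          z , z∈ , z-above = member-Above a≤u u<v v≤b
      in  z , (p , u , a≤p , p<u , ℚ.≤-trans (ℚ.<⇒≤ u<v) v≤b , x∈ , z-above)
            , (v , q , ℚ.≤-trans a≤u (ℚ.<⇒≤ u<v) , v<q , q≤b , z∈ , y-above)

    ≺-inhabited : ∃₂ _≺_
    ≺-inhabited =
      let u , a<u , u<b = ℚ.<-dense a<b
          x , x∈ = nonEmpty (e a)
          y , y∈ , y-above = member-Above (ℚ.<⇒≤ a<u) u<b ℚ.≤-refl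
      in  x , y , a , u , ℚ.≤-refl , a<u , ℚ.<⇒≤ u<b , x∈ , y-above

    private ℚ↪S = DenseRelation.ℚ-embeds _≺_ ≺-trans ≺-dense (proj₂ (proj₂ ≺-inhabited))

    φ : ℚ → Carrier
    φ = proj₁ ℚ↪S

    φ-mono : ∀ {p q} → p ℚ.< q → φ p ≺ φ q
    φ-mono = proj₂ (proj₂ ℚ↪S)

    φ∈ : ∀ q → member (e b) (φ q)
    φ∈ q = let _ , _ , _ , p<q , q≤b , φ∈ , _ = proj₂ (proj₁ (proj₂ ℚ↪S) q) in
      e-mono (ℚ.≤-trans (ℚ.<⇒≤ p<q) q≤b) φ∈

    φ-above : ∀ q → Above a (φ q)
    φ-above q i steep below = let _ , _ , a≤p , p<q , _ , _ , above = proj₁ (proj₁ (proj₂ ℚ↪S) q) in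
      above i steep (Below-mono (ℚ.≤-trans a≤p (ℚ.<⇒≤ p<q)) below)

    φ-strict : ∀ {p q} → p ℚ.< q → ∀ i → Steep i a b → ¬ φ q ≤[ i ] φ p
    φ-strict p<q i steep φq≤φp = let _ , _ , _ , u<v , _ , φp∈ , above = φ-mono p<q in
      above i steep (_ , e-mono (ℚ.<⇒≤ u<v) φp∈ , φq≤φp)

    ≰⇒≥ : ∀ i {x y} → ¬ x ≤[ i ] y → y ≤[ i ] x
    ≰⇒≥ i {x} {y} x≰y with ≤[]-total i x y
    ... | inj₁ x≤y = ⊥-elim (x≰y x≤y)
    ... | inj₂ y≤x = y≤x

    φ-steep : ∀ {p q} → p ℚ.≤ q → ∀ i → Steep i a b → φ p ≤[ i ] φ q
    φ-steep {p} {q} p≤q i steep with ℚ.<-cmp p q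
    ... | tri< p<q _ _  = ≰⇒≥ i (φ-strict p<q i steep)
    ... | tri≈ _ refl _ = ≤⇒≤[] ≤-refl
    ... | tri> _ _ q<p  = ⊥-elim (<⇒≱ q<p p≤q)

    -- In steep coordinates `φ q` escapes `e a`, so by totality it exceeds every `h` of `e a`, and
    -- joining `h` changes nothing there.
    ∨φ-steep : ∀ {h} → member (e a) h → ∀ q i → Steep i a b → (h ∨ φ q) ≤[ i ] φ q
    ∨φ-steep {h} h∈ q i steep =
      ≤[]-lub (≰⇒≥ i λ φq≤h → φ-above q i steep (h , h∈ , φq≤h)) (≤⇒≤[] ≤-refl)

    FlatMaximal : Carrier → Set _
    FlatMaximal h = ∀ i → Flat i a b → ∀ z → member (e a) z → z ≤[ i ] h

    -- By flatness and maximality `h` absorbs `φ q` in the flat coordinates, so `h ∨ φ q` is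
    -- constant there and varies as `φ q` in the steep ones.
    FlatMaximal⇒OrderEmbedding : ∀ {h} → member (e a) h → FlatMaximal h →
                                 OrderEmbedding ℚ-poset (JoinSemilattice.poset S)
    FlatMaximal⇒OrderEmbedding {h} h∈ maximal =
      strictlyMonotone⇒OrderEmbedding (JoinSemilattice.poset S) (λ q → h ∨ φ q) λ p<q →
        ≤[]⇒≤ (λ i → increasing p<q i (flatOrSteep i)) ,
        λ q≤p → let i , steep = some-steep in
          φ-strict p<q i steep
            (≤[]-trans (≤⇒≤[] (≤-trans (y≤x∨y h (φ _)) q≤p)) (∨φ-steep h∈ _ i steep))
      where
      increasing : ∀ {p q} → p ℚ.< q → ∀ i → FlatOrSteep i a b → (h ∨ φ p) ≤[ i ] (h ∨ φ q)
      increasing {p} {q} p<q i (inj₁ flat) = let z , z∈ , φp≤z = flat (φ p) (φ∈ p) in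
        ≤[]-lub (≤⇒≤[] (x≤x∨y h (φ q)))
          (≤[]-trans φp≤z (≤[]-trans (maximal i flat z z∈) (≤⇒≤[] (x≤x∨y h (φ q)))))
      increasing {p} {q} p<q i (inj₂ steep) =
        ≤[]-trans (∨φ-steep h∈ p i steep)
          (≤[]-trans (φ-steep (ℚ.<⇒≤ p<q) i steep) (≤⇒≤[] (y≤x∨y h (φ q))))

    DominatesLevel : ℕ → Carrier → Set _
    DominatesLevel m t = ∀ (r : Dyadic) → Integral m (value r) → ∀ i → Flat i a b → φ (value r) ≤[ i ] t

    abstract
      -- There are finitely many pairs of a fraction of level `m` and a flat coordinate; flatness
      -- bounds each by an element of `e a`, and `e a` is directed.
      level-bound : ∀ m → ∃ λ t → member (e a) t × DominatesLevel m t
      level-bound m =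
        let t , t∈ , ≤t = finite-bound (e a) (λ k → proj₁ (flat-bound (fraction m k)))
                                             (λ k → proj₁ (proj₂ (flat-bound (fraction m k))))
        in  t , t∈ , λ r integral i flat → let k , r≡ = Integral⇒fraction m r integral in
              subst (λ q → φ q ≤[ i ] t) (sym r≡)
                (≤[]-trans (proj₂ (proj₂ (flat-bound (fraction m k))) i flat) (≤⇒≤[] (≤t k)))
        where
        flat-bound : ∀ q → ∃ λ t → member (e a) t × (∀ i → Flat i a b → φ q ≤[ i ] t)
        flat-bound q =
          let t , t∈ , ≤t = finite-bound (e a) (λ i → proj₁ (point i)) (λ i → proj₁ (proj₂ (point i))) in
          t , t∈ , λ i flat → ≤[]-trans (proj₂ (proj₂ (point i)) flat) (≤⇒≤[] (≤t i))
          where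
          point : ∀ i → ∃ λ t → member (e a) t × (Flat i a b → φ q ≤[ i ] t)
          point i with em {P = Flat i a b}
          ... | yes flat = let t , t∈ , φq≤t = flat (φ q) (φ∈ q) in t , t∈ , λ _ → φq≤t
          ... | no ¬flat = let t , t∈ = nonEmpty (e a) in t , t∈ , λ flat → ⊥-elim (¬flat flat)

    -- Ω(η) embedded when no element of `e a` is maximal in all flat coordinates

    module _ (noMaximal : ¬ ∃ λ h → member (e a) h × FlatMaximal h) where

      grow : ∀ {h} → member (e a) h → ∃ λ z → member (e a) z × ∃ λ i → Flat i a b × ¬ z ≤[ i ] h
      grow {h} h∈ = decidable-stable em λ noGrowth → noMaximal (h , h∈ , λ i flat z z∈ →
        decidable-stable em λ z≰h → noGrowth (z , z∈ , i , flat , z≰h))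

      ladder : ℕ → ∃ (member (e a))
      ladder zero    = let t , t∈ , _ = level-bound zero in t , t∈
      ladder (suc m) =
        let h , h∈     = ladder m
            z , z∈ , _ = grow h∈
            t , t∈ , _ = level-bound (suc m)
        -- Here `z` forces growth in a flat coordinate and `t` dominates the next level.
        in  (h ∨ z) ∨ t , ∨-closed (e a) (∨-closed (e a) h∈ z∈) t∈

      h : ℕ → Carrier
      h m = proj₁ (ladder m)

      h-mono : ∀ {m m′} → m ℕ.≤ m′ → h m ≤ h m′
      h-mono m≤m′ = h-mono′ (ℕ.≤⇒≤′ m≤m′)
        where
        h-mono′ : ∀ {m m′} → m ℕ.≤′ m′ → h m ≤ h m′
        h-mono′ ℕ.≤′-refl        = ≤-refl
        h-mono′ (ℕ.≤′-step m≤m′) = ≤-trans (h-mono′ m≤m′) (≤-trans (x≤x∨y _ _) (x≤x∨y _ _))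

      h-dominates : ∀ m → DominatesLevel m (h m)
      h-dominates zero    = proj₂ (proj₂ (level-bound zero))
      h-dominates (suc m) r integral i flat =
        ≤[]-trans (proj₂ (proj₂ (level-bound (suc m))) r integral i flat) (≤⇒≤[] (y≤x∨y _ _))

      -- The growing coordinate may change with `m`; monotonicity of `h` makes this enough to
      -- distinguish any two levels.
      h-strict : ∀ m → ∃ λ i → Flat i a b × ¬ h (suc m) ≤[ i ] h m
      h-strict m = let _ , _ , i , flat , z≰h = grow (proj₂ (ladder m)) in
        i , flat , λ h≤ → z≰h (≤[]-trans (≤⇒≤[] (≤-trans (y≤x∨y _ _) (x≤x∨y _ _))) h≤)

      module Ω = JoinSemilattice Ωη

      f : Ω.Carrier → Carrier
      f ((m , r) , _) = h m ∨ φ (value r)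

      f-steep : ∀ ω i → Steep i a b → f ω ≤[ i ] φ (value (proj₂ (proj₁ ω)))
      f-steep ((m , r) , _) = ∨φ-steep (proj₂ (ladder m)) (value r)

      -- This is where membership in Ω(η) enters: `2 ^ m` times `r` is an integer, so `h m` absorbs
      -- `φ r` in the flat coordinates.
      f-flat : ∀ ω i → Flat i a b → f ω ≤[ i ] h (proj₁ (proj₁ ω))
      f-flat ((m , r) , integral) i flat = ≤[]-lub (≤⇒≤[] ≤-refl) (h-dominates m r integral i flat)

      h≤f : ∀ ω → h (proj₁ (proj₁ ω)) ≤ f ω
      h≤f _ = x≤x∨y _ _

      φ≤f : ∀ ω → φ (value (proj₂ (proj₁ ω))) ≤ f ω
      φ≤f _ = y≤x∨y _ _

      f-mono : ∀ {ω υ} → ω Ω.≤ υ → f ω ≤ f υ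
      f-mono {ω} {υ} (m≤m′ , r≤r′) = ≤[]⇒≤ λ i → at i (flatOrSteep i)
        where
        at : ∀ i → FlatOrSteep i a b → f ω ≤[ i ] f υ
        at i (inj₁ flat)  = ≤[]-trans (f-flat ω i flat) (≤⇒≤[] (≤-trans (h-mono m≤m′) (h≤f υ)))
        at i (inj₂ steep) = ≤[]-trans (f-steep ω i steep) (≤[]-trans (φ-steep r≤r′ i steep) (≤⇒≤[] (φ≤f υ)))

      -- Each coordinate of `f` is governed by a single chain, `m` if flat and `r` if steep. A join
      -- in a chain is one of its arguments, so `f ω` or `f υ` already bounds that coordinate.
      f-homo : ∀ ω υ → f (ω Ω.∨ υ) ≈ (f ω ∨ f υ)
      f-homo ω@((m , r) , _) υ@((m′ , r′) , _) = antisym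
        (≤[]⇒≤ λ i → at i (flatOrSteep i))
        (∨-least (f-mono {ω} {ω Ω.∨ υ} (Ω.x≤x∨y ω υ)) (f-mono {υ} {ω Ω.∨ υ} (Ω.y≤x∨y ω υ)))
        where
        χ = ω Ω.∨ υ

        at : ∀ i → FlatOrSteep i a b → f χ ≤[ i ] (f ω ∨ f υ)
        at i (inj₁ flat) = ≤[]-trans (f-flat χ i flat) (≤⇒≤[] (hχ≤ (Max.⊔-sel ℕ.≤-totalOrder m m′)))
          where
          hχ≤ : proj₁ (proj₁ χ) ≡ m ⊎ proj₁ (proj₁ χ) ≡ m′ → h (proj₁ (proj₁ χ)) ≤ (f ω ∨ f υ)
          hχ≤ (inj₁ eq) rewrite eq = ≤-trans (h≤f ω) (x≤x∨y _ _)
          hχ≤ (inj₂ eq) rewrite eq = ≤-trans (h≤f υ) (y≤x∨y _ _)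
        at i (inj₂ steep) = ≤[]-trans (f-steep χ i steep) (≤⇒≤[] (φχ≤ (Max.⊔-sel D r r′)))
          where
          rχ = value (proj₂ (proj₁ χ))
          φχ≤ : rχ ≡ value r ⊎ rχ ≡ value r′ → φ rχ ≤ (f ω ∨ f υ)
          φχ≤ (inj₁ eq) rewrite eq = ≤-trans (φ≤f ω) (x≤x∨y _ _)
          φχ≤ (inj₂ eq) rewrite eq = ≤-trans (φ≤f υ) (y≤x∨y _ _)

      f-cancel : ∀ {ω υ} → f ω ≤ f υ → ω Ω.≤ υ
      f-cancel {ω@((m , r) , _)} {υ@((m′ , r′) , _)} fω≤fυ = ℕ.≮⇒≥ m′≮m , ℚ.≮⇒≥ r′≮r
        where
        -- In the coordinate where `h` grows at step `m′`, `f υ` reaches only `h m′`, whereas `f ω`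
        -- is at least `h (suc m′)`.
        m′≮m : ¬ m′ ℕ.< m
        m′≮m m′<m = let i , flat , h≰ = h-strict m′ in
          h≰ (≤[]-trans (≤⇒≤[] (≤-trans (h-mono m′<m) (≤-trans (h≤f ω) fω≤fυ))) (f-flat υ i flat))

        r′≮r : ¬ value r′ ℚ.< value r
        r′≮r r′<r = let i , steep = some-steep in
          φ-strict r′<r i steep (≤[]-trans (≤⇒≤[] (≤-trans (φ≤f ω) fω≤fυ)) (f-steep υ i steep))

      Ωη-embeds : JoinEmbedding Ωη S
      Ωη-embeds = f , record
        { isMagmaHomomorphism = record
          { isRelHomomorphism = record { cong = λ { (m≡ , r≡) → Eq.reflexive (cong₂ (λ m r → h m ∨ φ r) m≡ r≡) } }
          ; homo = f-homo
          }
        ; injective = λ {ω} {υ} eq →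
            Ω.antisym {ω} {υ} (f-cancel {ω} {υ} (≤-reflexive eq)) (f-cancel {υ} {ω} (≤-reflexive (Eq.sym eq)))
        }

  ℚ-or-Ωη-embeds : OrderEmbedding ℚ-poset (JoinSemilattice.poset S) ⊎ JoinEmbedding Ωη S
  ℚ-or-Ωη-embeds
    -- The search for a subinterval starts from `[0 , 1]`.
    with a , b , a<b , flatOrSteep ← subinterval FlatOrSteep FlatOrSteep-hereditary FlatOrSteep-attained (ℚ.positive⁻¹ 1ℚ)
    with em {P = ∃ λ h → member (e a) h × Interval.FlatMaximal a<b flatOrSteep h}
  ... | yes (h , h∈ , maximal) = inj₁ (Interval.FlatMaximal⇒OrderEmbedding a<b flatOrSteep h∈ maximal)
  ... | no noMaximal           = inj₂ (Interval.Ωη-embeds a<b flatOrSteep noMaximal)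

theorem9p7 : (∀ {ℓ} → ExcludedMiddle ℓ) →
    ∀ {c ℓ₁ ℓ₂} (P : BoundedJoinSemilattice c ℓ₁ ℓ₂) (n : ℕ) →
    JoinDimensionIs (Fin n) (joinSemilattice P) →
    OrderScattered (idealPoset (poset P)) ⇔
    (OrderScattered (poset P) × ¬ JoinEmbedding Ωη (joinSemilattice P))
theorem9p7 em P n (embeds , _) = mk⇔
  (λ scattered → scattered-Id⇒scattered S scattered , scattered-Id⇒no-Ωη S scattered)
  (λ { (scattered , noΩη) I → Sum.[ scattered , noΩη ] (IdealChain.ℚ-or-Ωη-embeds em (realizer {S = S} embeds) I) })
  where S = joinSemilattice P
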